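{- Let $(\sigma',u')$ and $(\sigma'',u'')$ be colored permutations. Then $$\mathbf{G}_{\sigma',u'}\,\mathbf{G}_{\sigma'',u''}=\sum_{\sigma\in\sigma'*\sigma''}\mathbf{G}_{\sigma,\,u'\cdot u''},$$ where $u'\cdot u''$ is the concatenation of the color words. Therefore the elements $\mathbf{G}_{\sigma,u}$, over all colored permutations $(\sigma,u)$, span a $\mathbb{Z}$-subalgebra $\mathbf{FQSym}^{(\ell)}$ of the free associative algebra over $\mathbb{Z}$ on the colored alphabet $\boldsymbol{A}=A\times C$.
   Context: Let $C$ be a set of $\ell$ colors, $A=\{1<2<3<\cdots\}$, and $\boldsymbol{A}=A\times C$. A word of length $n$ over $\boldsymbol{A}$ is written as a pair $(v,u)$ with $v\in A^n$, $u\in C^n$; concatenation is done separately on both components. The standardization $\mathrm{Std}(v)\in\mathfrak{S}_n$ of $v\in A^n$ is the permutation having the same inversions as $v$ (number from left to right the occurrences of the smallest letter by $1,2,\ldots$, then continue with the occurrences of the next letter, and so on). The colored standardization of $(v,u)$ is $\mathbf{Std}(v,u)=(\mathrm{Std}(v),u)$. A colored permutation of size $n$ is a pair $(\sigma,u)$ with $\sigma\in\mathfrak{S}_n$, $u\in C^n$. Set $$\mathbf{G}_{\sigma,u}=\sum_{w\in\boldsymbol{A}^n,\ \mathbf{Std}(w)=(\sigma,u)}w,$$ an infinite formal sum of words of length $n$ (as usual, one works in the algebra of formal, possibly infinite, $\mathbb{Z}$-linear combinations of words of bounded degree over $\boldsymbol{A}$). The convolution $\sigma'*\sigma''$ of $\sigma'\in\mathfrak{S}_p$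 and $\sigma''\in\mathfrak{S}_q$ is the set of all $\tau\in\mathfrak{S}_{p+q}$ such that the standardization of the word of the first $p$ letters of $\tau$ is $\sigma'$ and the standardization of the word of the last $q$ letters of $\tau$ is $\sigma''$. -}

module Defs where

open import Algebra.Bundles using (Ring)
open import Data.Bool.Base using (if_then_else_; true)
open import Data.Fin.Base as Fin using (Fin; zero; suc; toℕ; fromℕ<; punchIn; punchOut)
import Data.Fin.Properties as Fin
open import Data.Fin.Permutation using (Permutation′; permutation; _⟨$⟩ʳ_; insert; remove; insert-remove)
  renaming (_≈_ to _≈ₚ_)
import Data.Fin.Permutation as Perm
open import Data.Fin.Subset using (Subset; ∣_∣; _⊂_) renaming (_∈_ to _∈ₛ_)
open import Data.Fin.Subset.Properties using (∈⊤; ⊆⊤; ∣⊤∣≡n; p⊂q⇒∣p∣<∣q∣)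
open import Data.Integer.Base as ℤ using (ℤ; 0ℤ; 1ℤ)
import Data.Integer.Properties as ℤ
open import Algebra.Properties.CommutativeSemigroup ℤ.+-commutativeSemigroup using (interchange)
open import Data.List.Base as List using (List; []; _∷_; length)
import Data.List.Membership.Setoid as Membership
open import Data.List.Membership.Setoid.Properties using (∈-cartesianProductWith⁺; ∈-resp-≈)
open import Data.List.Membership.Propositional.Properties using (∈-allFin)
open import Data.List.Relation.Unary.All as All using (All; []; _∷_)
import Data.List.Relation.Unary.All.Properties as All
open import Data.List.Relation.Unary.Any using (here)
open import Data.List.Relation.Unary.Unique.Setoid using (Unique)
open import Data.List.Relation.Unary.AllPairs.Core using ([]; _∷_)
open import Data.List.Relation.Unary.Unique.Setoid.Properties using (cartesianProductWith⁺)
open import Data.List.Relation.Unary.Unique.Propositional.Properties using (allFin⁺)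
open import Data.Nat.Base as ℕ using (ℕ; _+_; _<_; _≤_; _>_; _⊔_)
import Data.Nat.Properties as ℕ
open import Data.Product.Base as Product using (∃; _×_; _,_; proj₁; proj₂)
open import Data.Sum.Base using (_⊎_; inj₁; inj₂)
open import Data.Vec.Base as Vec using (Vec; lookup; tabulate; fromList)
import Data.Vec.Properties as Vec
open import Function.Base using (_∘_)
open import Function.Bundles using (_⇔_; mk⇔)
open import Function.Definitions using (Injective)
open import Level using (0ℓ)
open import Relation.Binary.Bundles using (Setoid)
open import Relation.Binary.Definitions using (Decidable; tri<; tri≈; tri>)
open import Relation.Binary.PropositionalEquality
open import Relation.Nullary.Decidable using (Dec; yes; no; does; map′; _×-dec_; _⊎-dec_; dec-true; dec-false)
open import Relation.Nullary.Negation using (¬_; contradiction)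
open import Relation.Unary using (Pred)

private
  variable
    m n p q ℓ : ℕ
    S X : Set

------------------------------------------------------------------------
-- Formal ℤ-linear combinations, possibly infinite but of bounded degree,
-- of words over an alphabet X.

record Series (X : Set) : Set where
  field
    coeff    : List X → ℤ
    degree   : ℕ
    vanishes : ∀ w → degree < length w → coeff w ≡ 0ℤ

open Series public

infix 4 _≈_

-- The degree bound is not part of the data of a series.
_≈_ : Series X → Series X → Set
f ≈ g = ∀ w → coeff f w ≡ coeff g w

splits : List X → List (List X × List X)
splits []      = ([] , []) ∷ []
splits (a ∷ w) = ([] , a ∷ w) ∷ List.map (Product.map₁ (a ∷_)) (splits w)

sumℤ : List S → (S → ℤ) → ℤ
sumℤ xs F = List.foldr (λ x s → F x ℤ.+ s) 0ℤ xs

-- The Cauchy product: the coefficient of w collects all factorizations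
-- of w as a concatenation x · y.
cauchy : (List X → ℤ) → (List X → ℤ) → List X → ℤ
cauchy f g w = sumℤ (splits w) λ (x , y) → f x ℤ.* g y

sumℤ-0 : ∀ {F : S → ℤ} {xs} → All (λ x → F x ≡ 0ℤ) xs → sumℤ xs F ≡ 0ℤ
sumℤ-0 []       = refl
sumℤ-0 (e ∷ es) = cong₂ ℤ._+_ e (sumℤ-0 es)

splits-length : (w : List X) →
                All (λ (x , y) → length x + length y ≡ length w) (splits w)
splits-length []      = refl ∷ []
splits-length (a ∷ w) = refl ∷ All.map⁺ (All.map (cong ℕ.suc) (splits-length w))

cauchy-vanishes : (f g : Series X) → ∀ w → degree f + degree g < length w →
                  cauchy (coeff f) (coeff g) w ≡ 0ℤ
cauchy-vanishes f g w d<w = sumℤ-0 (All.map term (splits-length w))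
  where
  term : ∀ {xy} → length (proj₁ xy) + length (proj₂ xy) ≡ length w →
         coeff f (proj₁ xy) ℤ.* coeff g (proj₂ xy) ≡ 0ℤ
  term {x , y} eq with degree f ℕ.<? length x | degree g ℕ.<? length y
  ... | yes d<x | _       = cong (ℤ._* coeff g y) (vanishes f x d<x)
  ... | no  _   | yes d<y = trans (cong (coeff f x ℤ.*_) (vanishes g y d<y))
                                  (ℤ.*-zeroʳ (coeff f x))
  ... | no  d≮x | no  d≮y = contradiction
    (subst (_≤ degree f + degree g) eq (ℕ.+-mono-≤ (ℕ.≮⇒≥ d≮x) (ℕ.≮⇒≥ d≮y)))
    (ℕ.<⇒≱ d<w)

infixl 6 _⊕_
infixl 7 _⊛_
infixr 8 _•_ ⊖_

_⊕_ : Series X → Series X → Series X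
coeff    (f ⊕ g) w = coeff f w ℤ.+ coeff g w
degree   (f ⊕ g)   = degree f ⊔ degree g
vanishes (f ⊕ g) w d<w = cong₂ ℤ._+_
  (vanishes f w (ℕ.≤-<-trans (ℕ.m≤m⊔n _ _) d<w))
  (vanishes g w (ℕ.≤-<-trans (ℕ.m≤n⊔m (degree f) _) d<w))

⊖_ : Series X → Series X
coeff    (⊖ f) w     = ℤ.- coeff f w
degree   (⊖ f)       = degree f
vanishes (⊖ f) w d<w = cong ℤ.-_ (vanishes f w d<w)

_•_ : ℤ → Series X → Series X
coeff    (k • f) w     = k ℤ.* coeff f w
degree   (k • f)       = degree f
vanishes (k • f) w d<w = trans (cong (k ℤ.*_) (vanishes f w d<w)) (ℤ.*-zeroʳ k)

_⊛_ : Series X → Series X → Series X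
coeff    (f ⊛ g) = cauchy (coeff f) (coeff g)
degree   (f ⊛ g) = degree f + degree g
vanishes (f ⊛ g) = cauchy-vanishes f g

𝟘 : Series X
coeff    𝟘 _   = 0ℤ
degree   𝟘     = 0
vanishes 𝟘 _ _ = refl

-- The empty word.
𝟙 : Series X
coeff    𝟙 []      = 1ℤ
coeff    𝟙 (_ ∷ _) = 0ℤ
degree   𝟙         = 0
vanishes 𝟙 (_ ∷ _) _ = refl

ℤ-+-congʳ : ∀ k {a b} → a ≡ b → k ℤ.+ a ≡ k ℤ.+ b
ℤ-+-congʳ k refl = refl

sumℤ-map : ∀ {S T : Set} (F : T → ℤ) (h : S → T) xs →
           sumℤ (List.map h xs) F ≡ sumℤ xs (F ∘ h)
sumℤ-map F h []       = refl
sumℤ-map F h (x ∷ xs) = ℤ-+-congʳ (F (h x)) (sumℤ-map F h xs)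

sumℤ-cong : ∀ (F G : S → ℤ) → F ≗ G → ∀ xs → sumℤ xs F ≡ sumℤ xs G
sumℤ-cong F G F≗G []       = refl
sumℤ-cong F G F≗G (x ∷ xs) = cong₂ ℤ._+_ (F≗G x) (sumℤ-cong F G F≗G xs)

sumℤ-+ : ∀ (F G : S → ℤ) xs →
         sumℤ xs (λ x → F x ℤ.+ G x) ≡ sumℤ xs F ℤ.+ sumℤ xs G
sumℤ-+ F G []       = refl
sumℤ-+ F G (x ∷ xs) = trans (ℤ-+-congʳ (F x ℤ.+ G x) (sumℤ-+ F G xs))
                            (interchange (F x) (G x) (sumℤ xs F) (sumℤ xs G))

sumℤ-* : ∀ k (F : S → ℤ) xs → sumℤ xs (λ x → k ℤ.* F x) ≡ k ℤ.* sumℤ xs F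
sumℤ-* k F []       = sym (ℤ.*-zeroʳ k)
sumℤ-* k F (x ∷ xs) = trans (ℤ-+-congʳ (k ℤ.* F x) (sumℤ-* k F xs))
                            (sym (ℤ.*-distribˡ-+ k (F x) (sumℤ xs F)))

cauchy-∷ : (f g : List X → ℤ) → ∀ a w →
           cauchy f g (a ∷ w) ≡ f [] ℤ.* g (a ∷ w) ℤ.+ cauchy (f ∘ (a ∷_)) g w
cauchy-∷ f g a w = ℤ-+-congʳ (f [] ℤ.* g (a ∷ w))
  (sumℤ-map (λ (x , y) → f x ℤ.* g y) (Product.map₁ (a ∷_)) (splits w))

cauchy-cong : (f f′ g g′ : List X → ℤ) → f ≗ f′ → g ≗ g′ → cauchy f g ≗ cauchy f′ g′
cauchy-cong f f′ g g′ f≗ g≗ w =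
  sumℤ-cong (λ (x , y) → f x ℤ.* g y) (λ (x , y) → f′ x ℤ.* g′ y)
            (λ (x , y) → cong₂ ℤ._*_ (f≗ x) (g≗ y)) (splits w)

cauchy-+ˡ : ∀ (f g h : List X → ℤ) w →
            cauchy (λ x → f x ℤ.+ g x) h w ≡ cauchy f h w ℤ.+ cauchy g h w
cauchy-+ˡ f g h w = trans
  (sumℤ-cong (λ (x , y) → (f x ℤ.+ g x) ℤ.* h y) (λ (x , y) → f x ℤ.* h y ℤ.+ g x ℤ.* h y)
             (λ (x , y) → ℤ.*-distribʳ-+ (h y) (f x) (g x)) (splits w))
  (sumℤ-+ (λ (x , y) → f x ℤ.* h y) (λ (x , y) → g x ℤ.* h y) (splits w))

cauchy-+ʳ : ∀ (f g h : List X → ℤ) w →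
            cauchy f (λ x → g x ℤ.+ h x) w ≡ cauchy f g w ℤ.+ cauchy f h w
cauchy-+ʳ f g h w = trans
  (sumℤ-cong (λ (x , y) → f x ℤ.* (g y ℤ.+ h y)) (λ (x , y) → f x ℤ.* g y ℤ.+ f x ℤ.* h y)
             (λ (x , y) → ℤ.*-distribˡ-+ (f x) (g y) (h y)) (splits w))
  (sumℤ-+ (λ (x , y) → f x ℤ.* g y) (λ (x , y) → f x ℤ.* h y) (splits w))

cauchy-*ˡ : ∀ k (f g : List X → ℤ) w →
            cauchy (λ x → k ℤ.* f x) g w ≡ k ℤ.* cauchy f g w
cauchy-*ˡ k f g w = trans
  (sumℤ-cong (λ (x , y) → k ℤ.* f x ℤ.* g y) (λ (x , y) → k ℤ.* (f x ℤ.* g y))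
             (λ (x , y) → ℤ.*-assoc k (f x) (g y)) (splits w))
  (sumℤ-* k (λ (x , y) → f x ℤ.* g y) (splits w))

cauchy-0ˡ : ∀ (g : List X → ℤ) w → cauchy (λ _ → 0ℤ) g w ≡ 0ℤ
cauchy-0ˡ g w = sumℤ-0 (All.universal (λ _ → refl) (splits w))

cauchy-assoc : ∀ (f g h : List X → ℤ) w →
               cauchy (cauchy f g) h w ≡ cauchy f (cauchy g h) w
cauchy-assoc f g h [] = cong (ℤ._+ 0ℤ) (begin
  (f [] ℤ.* g [] ℤ.+ 0ℤ) ℤ.* h []   ≡⟨ cong (ℤ._* h []) (ℤ.+-identityʳ (f [] ℤ.* g [])) ⟩
  f [] ℤ.* g [] ℤ.* h []            ≡⟨ ℤ.*-assoc (f []) (g []) (h []) ⟩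
  f [] ℤ.* (g [] ℤ.* h [])          ≡⟨ cong (f [] ℤ.*_) (ℤ.+-identityʳ (g [] ℤ.* h [])) ⟨
  f [] ℤ.* (g [] ℤ.* h [] ℤ.+ 0ℤ)   ∎)
  where open ≡-Reasoning
cauchy-assoc f g h (a ∷ w) = begin
  cauchy (cauchy f g) h (a ∷ w)
    ≡⟨ cauchy-∷ (cauchy f g) h a w ⟩
  cauchy f g [] ℤ.* h (a ∷ w) ℤ.+ cauchy (cauchy f g ∘ (a ∷_)) h w
    ≡⟨ cong₂ (λ y z → y ℤ.* h (a ∷ w) ℤ.+ z) (ℤ.+-identityʳ (f [] ℤ.* g [])) tail ⟩
  f [] ℤ.* g [] ℤ.* h (a ∷ w) ℤ.+ (f [] ℤ.* cauchy (g ∘ (a ∷_)) h w ℤ.+ cauchy (f ∘ (a ∷_)) (cauchy g h) w)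
    ≡⟨ regroup (f []) (g []) (h (a ∷ w)) (cauchy (g ∘ (a ∷_)) h w) (cauchy (f ∘ (a ∷_)) (cauchy g h) w) ⟩
  f [] ℤ.* (g [] ℤ.* h (a ∷ w) ℤ.+ cauchy (g ∘ (a ∷_)) h w) ℤ.+ cauchy (f ∘ (a ∷_)) (cauchy g h) w
    ≡⟨ cong (λ z → f [] ℤ.* z ℤ.+ cauchy (f ∘ (a ∷_)) (cauchy g h) w) (cauchy-∷ g h a w) ⟨
  f [] ℤ.* cauchy g h (a ∷ w) ℤ.+ cauchy (f ∘ (a ∷_)) (cauchy g h) w
    ≡⟨ cauchy-∷ f (cauchy g h) a w ⟨
  cauchy f (cauchy g h) (a ∷ w) ∎
  where
  open ≡-Reasoning
  regroup : ∀ a b c d e → a ℤ.* b ℤ.* c ℤ.+ (a ℤ.* d ℤ.+ e) ≡ a ℤ.* (b ℤ.* c ℤ.+ d) ℤ.+ e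
  regroup a b c d e = begin
    a ℤ.* b ℤ.* c ℤ.+ (a ℤ.* d ℤ.+ e)   ≡⟨ ℤ.+-assoc (a ℤ.* b ℤ.* c) (a ℤ.* d) e ⟨
    a ℤ.* b ℤ.* c ℤ.+ a ℤ.* d ℤ.+ e     ≡⟨ cong (λ z → z ℤ.+ a ℤ.* d ℤ.+ e) (ℤ.*-assoc a b c) ⟩
    a ℤ.* (b ℤ.* c) ℤ.+ a ℤ.* d ℤ.+ e   ≡⟨ cong (ℤ._+ e) (ℤ.*-distribˡ-+ a (b ℤ.* c) d) ⟨
    a ℤ.* (b ℤ.* c ℤ.+ d) ℤ.+ e         ∎
  tail : cauchy (cauchy f g ∘ (a ∷_)) h w ≡
         f [] ℤ.* cauchy (g ∘ (a ∷_)) h w ℤ.+ cauchy (f ∘ (a ∷_)) (cauchy g h) w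
  tail = begin
    cauchy (cauchy f g ∘ (a ∷_)) h w
      ≡⟨ cauchy-cong (cauchy f g ∘ (a ∷_)) (λ x → f [] ℤ.* g (a ∷ x) ℤ.+ cauchy (f ∘ (a ∷_)) g x) h h
           (cauchy-∷ f g a) (λ _ → refl) w ⟩
    cauchy (λ x → f [] ℤ.* g (a ∷ x) ℤ.+ cauchy (f ∘ (a ∷_)) g x) h w
      ≡⟨ cauchy-+ˡ (λ x → f [] ℤ.* g (a ∷ x)) (cauchy (f ∘ (a ∷_)) g) h w ⟩
    cauchy (λ x → f [] ℤ.* g (a ∷ x)) h w ℤ.+ cauchy (cauchy (f ∘ (a ∷_)) g) h w
      ≡⟨ cong₂ ℤ._+_ (cauchy-*ˡ (f []) (g ∘ (a ∷_)) h w) (cauchy-assoc (f ∘ (a ∷_)) g h w) ⟩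
    f [] ℤ.* cauchy (g ∘ (a ∷_)) h w ℤ.+ cauchy (f ∘ (a ∷_)) (cauchy g h) w ∎

cauchy-identityˡ : ∀ (f : List X → ℤ) w → cauchy (coeff 𝟙) f w ≡ f w
cauchy-identityˡ f [] = trans (ℤ.+-identityʳ _) (ℤ.*-identityˡ (f []))
cauchy-identityˡ f (a ∷ w) = begin
  cauchy (coeff 𝟙) f (a ∷ w)                    ≡⟨ cauchy-∷ (coeff 𝟙) f a w ⟩
  1ℤ ℤ.* f (a ∷ w) ℤ.+ cauchy (λ _ → 0ℤ) f w    ≡⟨ cong₂ ℤ._+_ (ℤ.*-identityˡ (f (a ∷ w))) (cauchy-0ˡ f w) ⟩
  f (a ∷ w) ℤ.+ 0ℤ                              ≡⟨ ℤ.+-identityʳ (f (a ∷ w)) ⟩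
  f (a ∷ w)                                     ∎
  where open ≡-Reasoning

cauchy-identityʳ : ∀ (f : List X → ℤ) w → cauchy f (coeff 𝟙) w ≡ f w
cauchy-identityʳ f [] = trans (ℤ.+-identityʳ _) (ℤ.*-identityʳ (f []))
cauchy-identityʳ f (a ∷ w) = begin
  cauchy f (coeff 𝟙) (a ∷ w)                         ≡⟨ cauchy-∷ f (coeff 𝟙) a w ⟩
  f [] ℤ.* 0ℤ ℤ.+ cauchy (f ∘ (a ∷_)) (coeff 𝟙) w    ≡⟨ cong₂ ℤ._+_ (ℤ.*-zeroʳ (f [])) (cauchy-identityʳ (f ∘ (a ∷_)) w) ⟩
  0ℤ ℤ.+ f (a ∷ w)                                   ≡⟨ ℤ.+-identityˡ _ ⟩
  f (a ∷ w)                                          ∎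
  where open ≡-Reasoning

freeAlgebra : Set → Ring 0ℓ 0ℓ
freeAlgebra X = record
  { Carrier = Series X
  ; _≈_     = _≈_
  ; _+_     = _⊕_
  ; _*_     = _⊛_
  ; -_      = ⊖_
  ; 0#      = 𝟘
  ; 1#      = 𝟙
  ; isRing  = record
    { +-isAbelianGroup = record
      { isGroup = record
        { isMonoid = record
          { isSemigroup = record
            { isMagma = record
              { isEquivalence = record
                { refl  = λ _ → refl
                ; sym   = λ f≈g w → sym (f≈g w)
                ; trans = λ f≈g g≈h w → trans (f≈g w) (g≈h w)
                }
              ; ∙-cong = λ f≈ g≈ w → cong₂ ℤ._+_ (f≈ w) (g≈ w)
              }
            ; assoc = λ f g h w → ℤ.+-assoc (coeff f w) (coeff g w) (coeff h w)
            }
          ; identity = (λ f w → ℤ.+-identityˡ (coeff f w)) , (λ f w → ℤ.+-identityʳ (coeff f w))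
          }
        ; inverse = (λ f w → ℤ.+-inverseˡ (coeff f w)) , (λ f w → ℤ.+-inverseʳ (coeff f w))
        ; ⁻¹-cong = λ f≈ w → cong ℤ.-_ (f≈ w)
        }
      ; comm = λ f g w → ℤ.+-comm (coeff f w) (coeff g w)
      }
    ; *-cong     = λ {f} {f′} {g} {g′} → cauchy-cong (coeff f) (coeff f′) (coeff g) (coeff g′)
    ; *-assoc    = λ f g h → cauchy-assoc (coeff f) (coeff g) (coeff h)
    ; *-identity = (λ f → cauchy-identityˡ (coeff f)) , (λ f → cauchy-identityʳ (coeff f))
    ; distrib    = (λ f g h → cauchy-+ʳ (coeff f) (coeff g) (coeff h))
                 , (λ f g h → cauchy-+ˡ (coeff g) (coeff h) (coeff f))
    }
  }

infix 5 ∑-syntax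

∑-syntax : List S → (S → Series X) → Series X
∑-syntax xs F = List.foldr (λ x s → F x ⊕ s) 𝟘 xs

syntax ∑-syntax xs (λ x → f) = ∑[ x ∈ xs ] f

Span : (S → Series X) → Pred (Series X) 0ℓ
Span {S = S} F f = ∃ λ (ks : List (ℤ × S)) → f ≈ ∑[ kx ∈ ks ] (proj₁ kx • F (proj₂ kx))

-- Closure under 𝟘 and ⊖_ follows from closure under scalars. Since equality of
-- series is the relation _≈_, a subset has to respect it.
record IsSubalgebra (P : Pred (Series X) 0ℓ) : Set where
  field
    resp-≈   : ∀ {f g} → f ≈ g → P f → P g
    ⊕-closed : ∀ {f g} → P f → P g → P (f ⊕ g)
    •-closed : ∀ k {f} → P f → P (k • f)
    𝟙-closed : P 𝟙
    ⊛-closed : ∀ {f g} → P f → P g → P (f ⊛ g)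

------------------------------------------------------------------------
-- Standardization

-- The letter k : ℕ stands for the k+1-st letter of the ordered alphabet
-- 1 < 2 < 3 < ⋯; values of permutations are likewise counted from 0.
Letter : Set
Letter = ℕ

module _ (v : Vec Letter n) where

  -- Before i j: the position j is numbered before the position i, since it
  -- carries a smaller letter, or the same letter further to the left.
  Before : Fin n → Fin n → Set
  Before i j = lookup v j < lookup v i ⊎ (lookup v j ≡ lookup v i × j Fin.< i)

  before? : Decidable Before
  before? i j = (lookup v j ℕ.<? lookup v i)
              ⊎-dec ((lookup v j ℕ.≟ lookup v i) ×-dec (j Fin.<? i))

  before : Fin n → Subset n
  before i = tabulate (λ j → does (before? i j))

  before-∈⁺ : ∀ {i j} → Before i j → j ∈ₛ before i
  before-∈⁺ {i} {j} b = Vec.lookup⇒[]= j _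
    (trans (Vec.lookup∘tabulate _ j) (dec-true (before? i j) b))

  before-∈⁻ : ∀ {i j} → j ∈ₛ before i → Before i j
  before-∈⁻ {i} {j} j∈ = witness (before? i j)
    (trans (sym (Vec.lookup∘tabulate (λ j → does (before? i j)) j)) (Vec.[]=⇒lookup j∈))
    where
    witness : ∀ {A : Set} (d : Dec A) → does d ≡ true → A
    witness (yes a) _ = a

  before-irrefl : ∀ {i} → ¬ Before i i
  before-irrefl (inj₁ x<x)       = ℕ.<-irrefl refl x<x
  before-irrefl (inj₂ (_ , i<i)) = ℕ.<-irrefl refl i<i

  before-trans : ∀ {i j k} → Before j k → Before i j → Before i k
  before-trans (inj₁ x)       (inj₁ y)        = inj₁ (ℕ.<-trans x y)
  before-trans (inj₁ x)       (inj₂ (y , _))  = inj₁ (ℕ.<-≤-trans x (ℕ.≤-reflexive y))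
  before-trans (inj₂ (x , _)) (inj₁ y)        = inj₁ (ℕ.≤-<-trans (ℕ.≤-reflexive x) y)
  before-trans (inj₂ (x , k<j)) (inj₂ (y , j<i)) = inj₂ (trans x y , ℕ.<-trans k<j j<i)

  before-total : ∀ i j → Before i j ⊎ i ≡ j ⊎ Before j i
  before-total i j with ℕ.<-cmp (lookup v i) (lookup v j) | Fin.<-cmp i j
  ... | tri< x _ _ | _            = inj₂ (inj₂ (inj₁ x))
  ... | tri> _ _ x | _            = inj₁ (inj₁ x)
  ... | tri≈ _ e _ | tri< i<j _ _ = inj₂ (inj₂ (inj₂ (e , i<j)))
  ... | tri≈ _ _ _ | tri≈ _ i≡j _ = inj₂ (inj₁ i≡j)
  ... | tri≈ _ e _ | tri> _ _ j<i = inj₁ (inj₂ (sym e , j<i))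

  before-⊂ : ∀ {i j} → Before i j → before j ⊂ before i
  before-⊂ {i} {j} b = (λ k∈ → before-∈⁺ (before-trans (before-∈⁻ k∈) b))
                     , j , before-∈⁺ b , before-irrefl ∘ before-∈⁻

  before-mono : ∀ {i j} → Before i j → ∣ before j ∣ < ∣ before i ∣
  before-mono b = p⊂q⇒∣p∣<∣q∣ (before-⊂ b)

  ∣before∣<n : ∀ i → ∣ before i ∣ < n
  ∣before∣<n i = subst (∣ before i ∣ <_) (∣⊤∣≡n n)
    (p⊂q⇒∣p∣<∣q∣ (⊆⊤ , i , ∈⊤ , before-irrefl ∘ before-∈⁻))

  -- The number given to position i, counted from 0.
  rank : Fin n → Fin n
  rank i = fromℕ< (∣before∣<n i)

  rank-mono : ∀ {i j} → Before i j → rank j Fin.< rank i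
  rank-mono {i} {j} b = subst₂ _<_ (sym (Fin.toℕ-fromℕ< (∣before∣<n j)))
                                   (sym (Fin.toℕ-fromℕ< (∣before∣<n i))) (before-mono b)

  rank-injective : Injective _≡_ _≡_ rank
  rank-injective {i} {j} eq with before-total i j
  ... | inj₁ b          = contradiction (sym eq) (Fin.<⇒≢ (rank-mono b))
  ... | inj₂ (inj₁ i≡j) = i≡j
  ... | inj₂ (inj₂ b)   = contradiction eq (Fin.<⇒≢ (rank-mono b))

injective⇒surjective : ∀ {f : Fin n → Fin n} → Injective _≡_ _≡_ f → ∀ y → ∃ λ x → f x ≡ y
injective⇒surjective {n = ℕ.suc n} {f} inj y with Fin.any? (λ x → f x Fin.≟ y)
... | yes hit  = hit
... | no  miss = contradiction
  (Fin.injective⇒≤ {f = λ x → punchOut {i = y} {j = f x} (λ e → miss (x , sym e))}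
    (λ e → inj (Fin.punchOut-injective {i = y} _ _ e)))
  ℕ.1+n≰n

injective⇒permutation : (f : Fin n → Fin n) → Injective _≡_ _≡_ f → Permutation′ n
injective⇒permutation f inj = permutation f (proj₁ ∘ surj) (proj₂ ∘ surj) (λ x → inj (proj₂ (surj (f x))))
  where surj = injective⇒surjective inj

-- By std-inversions, std v is the permutation with the same inversions as v.
std : Vec Letter n → Permutation′ n
std v = injective⇒permutation (rank v) (rank-injective v)

std-inversions : (v : Vec Letter n) → ∀ {i j} → i Fin.< j →
                 (std v ⟨$⟩ʳ i Fin.> std v ⟨$⟩ʳ j) ⇔ (lookup v i > lookup v j)
std-inversions v {i} {j} i<j = mk⇔ to (rank-mono v ∘ inj₁)
  where
  to : rank v j Fin.< rank v i → lookup v j < lookup v i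
  to r with before-total v i j
  ... | inj₁ (inj₁ x)         = x
  ... | inj₁ (inj₂ (_ , j<i)) = contradiction j<i (ℕ.<-asym i<j)
  ... | inj₂ (inj₁ refl)      = contradiction i<j (ℕ.<-irrefl refl)
  ... | inj₂ (inj₂ b)         = contradiction (rank-mono v b) (ℕ.<-asym r)

------------------------------------------------------------------------
-- Colored words and colored permutations

Color : ℕ → Set
Color ℓ = Fin ℓ

-- The pair (v , u) of a word is recovered by the projections.
Word : ℕ → Set
Word ℓ = List (Letter × Color ℓ)

letters : (w : Word ℓ) → Vec Letter (length w)
letters w = Vec.map proj₁ (fromList w)

colors : (w : Word ℓ) → Vec (Color ℓ) (length w)
colors w = Vec.map proj₂ (fromList w)

ColoredPerm : ℕ → Set
ColoredPerm ℓ = ∃ λ n → Permutation′ n × Vec (Color ℓ) n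

infix 4 _≋_ _≈ₚ?_ _≋?_

data _≋_ {ℓ} : ColoredPerm ℓ → ColoredPerm ℓ → Set where
  same : {σ τ : Permutation′ n} {u v : Vec (Color ℓ) n} →
         σ ≈ₚ τ → u ≡ v → (n , σ , u) ≋ (n , τ , v)

_≈ₚ?_ : Decidable (_≈ₚ_ {n} {n})
σ ≈ₚ? τ = Fin.all? (λ i → (σ ⟨$⟩ʳ i) Fin.≟ (τ ⟨$⟩ʳ i))

_≋?_ : Decidable (_≋_ {ℓ})
(m , σ , u) ≋? (n , τ , v) with m ℕ.≟ n
... | no  m≢n  = no λ { (same _ _) → m≢n refl }
... | yes refl = map′ (λ (e , e′) → same e e′) (λ { (same e e′) → e , e′ })
                      (σ ≈ₚ? τ ×-dec Vec.≡-dec Fin._≟_ u v)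

coloredStd : Word ℓ → ColoredPerm ℓ
coloredStd w = length w , std (letters w) , colors w

≋-size : {c d : ColoredPerm ℓ} → c ≋ d → proj₁ c ≡ proj₁ d
≋-size (same _ _) = refl

indicator : {P : Set} → Dec P → ℤ
indicator P? = if does P? then 1ℤ else 0ℤ

indicator-no : {P : Set} (P? : Dec P) → ¬ P → indicator P? ≡ 0ℤ
indicator-no P? ¬p = cong (if_then 1ℤ else 0ℤ) (dec-false P? ¬p)

G : ColoredPerm ℓ → Series (Letter × Color ℓ)
coeff    (G c) w = indicator (coloredStd w ≋? c)
degree   (G c)   = proj₁ c
vanishes (G c) w d<w = indicator-no (coloredStd w ≋? c) (ℕ.<⇒≢ d<w ∘ sym ∘ ≋-size)

FQSym : (ℓ : ℕ) → Pred (Series (Letter × Color ℓ)) 0ℓ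
FQSym ℓ = Span (G {ℓ})

------------------------------------------------------------------------
-- Convolution

permSetoid : ℕ → Setoid 0ℓ 0ℓ
permSetoid n = record
  { Carrier       = Permutation′ n
  ; _≈_           = _≈ₚ_
  ; isEquivalence = record
    { refl  = λ _ → refl
    ; sym   = λ e i → sym (e i)
    ; trans = λ e e′ i → trans (e i) (e′ i)
    }
  }

perms : ∀ n → List (Permutation′ n)
perms ℕ.zero    = Perm.id ∷ []
perms (ℕ.suc n) = List.cartesianProductWith (insert zero) (List.allFin (ℕ.suc n)) (perms n)

perms-complete : (σ : Permutation′ n) → Membership._∈_ (permSetoid n) σ (perms n)
perms-complete {n = ℕ.zero}  σ = here λ ()
perms-complete {n = ℕ.suc n} σ =
  ∈-resp-≈ (permSetoid _) {x = insert zero (σ ⟨$⟩ʳ zero) (remove zero σ)} {y = σ}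
    (insert-remove zero σ)
    (∈-cartesianProductWith⁺ (setoid _) (permSetoid n) (permSetoid _) {f = insert zero}
      (λ {j} {_} {π} {ρ} → λ { refl e → insert-cong j {π} {ρ} e })
      (∈-allFin (σ ⟨$⟩ʳ zero)) (perms-complete (remove zero σ)))
  where
  insert-cong : ∀ j {π ρ : Permutation′ n} → π ≈ₚ ρ → insert zero j π ≈ₚ insert zero j ρ
  insert-cong j e zero    = refl
  insert-cong j e (suc i) = cong (punchIn j) (e i)

perms-unique : ∀ n → Unique (permSetoid n) (perms n)
perms-unique ℕ.zero    = [] ∷ []
perms-unique (ℕ.suc n) =
  cartesianProductWith⁺ (setoid _) (permSetoid n) (permSetoid _) (insert zero)
    (λ {j} {k} {π} {ρ} → inj {j} {k} {π} {ρ}) (allFin⁺ (ℕ.suc n)) (perms-unique n)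
  where
  inj : ∀ {j k} {π ρ : Permutation′ n} → insert zero j π ≈ₚ insert zero k ρ → j ≡ k × π ≈ₚ ρ
  inj {j} {k} {π} {ρ} e with e zero
  ... | refl = refl , λ i → Fin.punchIn-injective j (π ⟨$⟩ʳ i) (ρ ⟨$⟩ʳ i) (e (suc i))

oneLine : Permutation′ n → Vec Letter n
oneLine σ = tabulate (λ i → toℕ (σ ⟨$⟩ʳ i))

InConvolution : Permutation′ (p + q) → Permutation′ p → Permutation′ q → Set
InConvolution {p} τ σ′ σ″ = std (Vec.take p (oneLine τ)) ≈ₚ σ′
                          × std (Vec.drop p (oneLine τ)) ≈ₚ σ″

inConvolution? : (τ : Permutation′ (p + q)) (σ′ : Permutation′ p) (σ″ : Permutation′ q) →
                 Dec (InConvolution τ σ′ σ″)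
inConvolution? {p} τ σ′ σ″ = (std (Vec.take p (oneLine τ)) ≈ₚ? σ′)
                       ×-dec (std (Vec.drop p (oneLine τ)) ≈ₚ? σ″)

infixl 7 _⋆_

-- The convolution set of σ′ and σ″, listed without repetition.
_⋆_ : Permutation′ p → Permutation′ q → List (Permutation′ (p + q))
_⋆_ {p} {q} σ′ σ″ = List.filter (λ τ → inConvolution? τ σ′ σ″) (perms (p + q))

{-# OPTIONS --safe #-}
-- A word with p + q letters factors uniquely as x · y with |x| = p and |y| = q,
-- so on both sides of the product formula its coefficient is 0 or 1. Since
-- standardization depends only on the relative order of the letters, the first
-- p and the last q letters of Std(x · y) standardize to Std(x) and Std(y); hence
-- Std(x · y) lies in σ′ ∗ σ″ exactly when Std(x) = σ′ and Std(y) = σ″.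
module Submission where

open import Defs
open import Data.Fin.Permutation using (Permutation′)
open import Data.Nat.Base using (ℕ; _+_)
open import Data.Product.Base using (_×_; _,_)
open import Data.Vec.Base using (Vec; _++_)

open import Data.Bool.Base using (true; false; if_then_else_)
open import Data.Fin.Base as Fin using (Fin; _↑ˡ_; _↑ʳ_; toℕ)
open import Data.Fin.Permutation using (_⟨$⟩ʳ_) renaming (_≈_ to _≈ₚ_)
import Data.Fin.Permutation as Perm
import Data.Fin.Properties as Fin
open import Data.Fin.Subset using (∣_∣)
open import Data.Integer.Base as ℤ using (ℤ; 0ℤ; 1ℤ)
import Data.Integer.Properties as ℤ
open import Data.List.Base as List using (List; []; _∷_; length)
import Data.List.Membership.Setoid as Membership
open import Data.List.Membership.Setoid.Properties using (∈-filter⁺)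
open import Data.List.Relation.Unary.All as All using (All; []; _∷_)
import Data.List.Relation.Unary.All.Properties as All
open import Data.List.Relation.Unary.AllPairs.Core using (_∷_)
open import Data.List.Relation.Unary.Any using (here; there)
open import Data.List.Relation.Unary.Unique.Setoid using (Unique)
open import Data.List.Relation.Unary.Unique.Setoid.Properties using (filter⁺)
open import Data.Nat.Base using (suc; _<_)
import Data.Nat.Properties as ℕ
open import Data.Product.Base as Product using (∃; ∃₂; proj₁; proj₂)
open import Data.Sum.Base using (inj₁; inj₂)
open import Data.Vec.Base as Vec using (lookup; fromList)
import Data.Vec.Properties as Vec
open import Function.Base using (_∘_)
open import Function.Bundles using (_⇔_; mk⇔; Equivalence)
open import Level using (0ℓ)
open import Relation.Binary.Bundles using (Setoid)
open import Relation.Binary.PropositionalEquality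
open import Relation.Nullary.Decidable using (Dec; yes; no; does; _×-dec_; does-⇔; dec-true)
open import Relation.Nullary.Negation using (¬_; contradiction)

private
  variable
    m n p q ℓ : ℕ
    S X : Set

-- Sums and indicators

coeff-∑ : ∀ (xs : List S) (F : S → Series X) w →
          coeff (∑[ x ∈ xs ] F x) w ≡ sumℤ xs (λ x → coeff (F x) w)
coeff-∑ []       F w = refl
coeff-∑ (x ∷ xs) F w = ℤ-+-congʳ (coeff (F x) w) (coeff-∑ xs F w)

module _ (A : Setoid 0ℓ 0ℓ) where
  open Setoid A using (Carrier) renaming (_≈_ to _∼_; sym to ∼-sym; trans to ∼-trans)
  open Membership A using (_∈_)

  -- Uniqueness up to the setoid equality leaves exactly one entry equivalent to `t`. The setoid
  -- version is the one that applies to permutations, which are compared pointwise by `_≈ₚ_`.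
  sumℤ-single : ∀ (F : Carrier → ℤ) {t k xs} → Unique A xs → t ∈ xs →
                (∀ {x} → t ∼ x → F x ≡ k) → (∀ {x} → ¬ t ∼ x → F x ≡ 0ℤ) → sumℤ xs F ≡ k
  sumℤ-single F (x≉xs ∷ _) (here t∼x) on off = trans
    (cong₂ ℤ._+_ (on t∼x)
      (sumℤ-0 (All.map (λ x≁y → off (λ t∼y → x≁y (∼-trans (∼-sym t∼x) t∼y))) x≉xs)))
    (ℤ.+-identityʳ _)
  sumℤ-single F {t} {xs = x ∷ _} (x≉xs ∷ uniq) (there t∈xs) on off = trans
    (cong₂ ℤ._+_ (off t≁x) (sumℤ-single F uniq t∈xs on off))
    (ℤ.+-identityˡ _)
    where
    -- `t` is equivalent to a later entry, and uniqueness separates `x` from every later entry.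
    distinct : ∀ {ys} → t ∈ ys → All (λ y → ¬ x ∼ y) ys → ¬ t ∼ x
    distinct (here t∼y)   (x≁y ∷ _) t∼x = x≁y (∼-trans (∼-sym t∼x) t∼y)
    distinct (there t∈ys) (_ ∷ x≁)      = distinct t∈ys x≁
    t≁x = distinct t∈xs x≉xs

indicator-yes : {P : Set} (P? : Dec P) → P → indicator P? ≡ 1ℤ
indicator-yes P? p = cong (if_then 1ℤ else 0ℤ) (dec-true P? p)

indicator-⇔ : {P Q : Set} (P? : Dec P) (Q? : Dec Q) → P ⇔ Q → indicator P? ≡ indicator Q?
indicator-⇔ P? Q? P⇔Q = cong (if_then 1ℤ else 0ℤ) (does-⇔ P⇔Q P? Q?)

indicator-× : {P Q : Set} (P? : Dec P) (Q? : Dec Q) →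
              indicator P? ℤ.* indicator Q? ≡ indicator (P? ×-dec Q?)
indicator-× P? Q? with does P? | does Q?
... | true  | true  = refl
... | true  | false = refl
... | false | true  = refl
... | false | false = refl

-- Among all factorizations of the word, only the one cut after `x` has a left factor on which `f`
-- may be nonzero. The induction strips the letters of `x` by passing from `f` to `f ∘ (a ∷_)`.
cauchy-++ : ∀ (f g : List X → ℤ) x y → (∀ z → length z ≢ length x → f z ≡ 0ℤ) →
            cauchy f g (x List.++ y) ≡ f x ℤ.* g y
cauchy-++ f g [] []      f-0 = ℤ.+-identityʳ (f [] ℤ.* g [])
cauchy-++ f g [] (b ∷ y) f-0 = begin
  cauchy f g (b ∷ y)                              ≡⟨ cauchy-∷ f g b y ⟩
  f [] ℤ.* g (b ∷ y) ℤ.+ cauchy (f ∘ (b ∷_)) g y  ≡⟨ ℤ-+-congʳ (f [] ℤ.* g (b ∷ y)) tail-0 ⟩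
  f [] ℤ.* g (b ∷ y) ℤ.+ 0ℤ                       ≡⟨ ℤ.+-identityʳ _ ⟩
  f [] ℤ.* g (b ∷ y)                              ∎
  where
  open ≡-Reasoning
  tail-0 : cauchy (f ∘ (b ∷_)) g y ≡ 0ℤ
  -- All remaining splits have a nonempty left factor, and `f` vanishes there.
  tail-0 = trans (cauchy-cong (f ∘ (b ∷_)) (λ _ → 0ℤ) g g (λ z → f-0 (b ∷ z) λ ()) (λ _ → refl) y)
                 (cauchy-0ˡ g y)
cauchy-++ f g (a ∷ x) y f-0 = begin
  cauchy f g (a ∷ x List.++ y)
    ≡⟨ cauchy-∷ f g a (x List.++ y) ⟩
  f [] ℤ.* g (a ∷ x List.++ y) ℤ.+ cauchy (f ∘ (a ∷_)) g (x List.++ y)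
    -- The empty left factor is too short, so its term is zero; `suc-injective` hands the vanishing
    -- hypothesis on to `f ∘ (a ∷_)`.
    ≡⟨ cong₂ (λ c s → c ℤ.* g (a ∷ x List.++ y) ℤ.+ s) (f-0 [] λ ())
             (cauchy-++ (f ∘ (a ∷_)) g x y (λ z z≢x → f-0 (a ∷ z) (z≢x ∘ ℕ.suc-injective))) ⟩
  0ℤ ℤ.+ f (a ∷ x) ℤ.* g y
    ≡⟨ ℤ.+-identityˡ _ ⟩
  f (a ∷ x) ℤ.* g y ∎
  where open ≡-Reasoning

-- Standardization of subwords

-- The rank of a position is the cardinality of a set determined by `Before`, so the standardization
-- depends on the letters only through this relation.
std-cong : (s t : Vec Letter n) → (∀ {i j} → Before s i j → Before t i j) → std s ≈ₚ std t
std-cong s t s⇒t i = Fin.fromℕ<-cong _ _ (cong ∣_∣ (Vec.tabulate-cong same-before)) _ _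
  where
  -- Both relations are strict total orders, so an inclusion is an equality.
  t⇒s : ∀ {i j} → Before t i j → Before s i j
  t⇒s {i} {j} b with before-total s i j
  ... | inj₁ b′          = b′
  ... | inj₂ (inj₁ refl) = contradiction b (before-irrefl t)
  ... | inj₂ (inj₂ b′)   = contradiction (before-trans t b (s⇒t b′)) (before-irrefl t)
  same-before : ∀ j → does (before? s i j) ≡ does (before? t i j)
  same-before j = does-⇔ (mk⇔ s⇒t t⇒s) (before? s i j) (before? t i j)

module _ (v : Vec Letter n) (ι : Fin m → Fin n) (ι-mono : ∀ {i j} → i Fin.< j → ι i Fin.< ι j) where

  -- Standardizing `v` first does not disturb the standardization of a subword: ranks in `v` order
  -- the chosen positions as `Before s` does. Monotonicity of `ι` makes ties break the same way in
  -- `s` and in `v`.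
  std-subword : (s t : Vec Letter m) → (∀ i → lookup s i ≡ lookup v (ι i)) →
                (∀ i → lookup t i ≡ lookup (oneLine (std v)) (ι i)) → std t ≈ₚ std s
  std-subword s t s≗v t≗std i = sym (std-cong s t s⇒t i)
    where
    s⇒v : ∀ {i j} → Before s i j → Before v (ι i) (ι j)
    s⇒v {i} {j} (inj₁ x)         = inj₁ (subst₂ _<_ (s≗v j) (s≗v i) x)
    s⇒v {i} {j} (inj₂ (e , j<i)) = inj₂ (trans (sym (s≗v j)) (trans e (s≗v i)) , ι-mono j<i)
    t≗rank : ∀ i → lookup t i ≡ toℕ (rank v (ι i))
    t≗rank i = trans (t≗std i) (Vec.lookup∘tabulate _ (ι i))
    s⇒t : ∀ {i j} → Before s i j → Before t i j
    -- Ranks are distinct, so even a tie in `s` becomes a strict inequality in `t`; hence always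
    -- `inj₁`.
    s⇒t {i} {j} b = inj₁ (subst₂ _<_ (sym (t≗rank j)) (sym (t≗rank i)) (rank-mono v (s⇒v b)))

module _ {A : Set} (w : Vec A (p + q)) where

  lookup-take : ∀ i → lookup (Vec.take p w) i ≡ lookup w (i ↑ˡ q)
  lookup-take i = trans (sym (Vec.lookup-++ˡ (Vec.take p w) (Vec.drop p w) i))
                        (cong (λ w′ → lookup w′ (i ↑ˡ q)) (Vec.take++drop≡id p w))

  lookup-drop : ∀ i → lookup (Vec.drop p w) i ≡ lookup w (p ↑ʳ i)
  lookup-drop i = trans (sym (Vec.lookup-++ʳ (Vec.take p w) (Vec.drop p w) i))
                        (cong (λ w′ → lookup w′ (p ↑ʳ i)) (Vec.take++drop≡id p w))

std-take-oneLine : (x : Vec Letter p) (y : Vec Letter q) →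
                   std (Vec.take p (oneLine (std (x ++ y)))) ≈ₚ std x
std-take-oneLine {p} {q} x y = std-subword (x ++ y) (_↑ˡ q)
  (λ {i} {j} → subst₂ _<_ (sym (Fin.toℕ-↑ˡ i q)) (sym (Fin.toℕ-↑ˡ j q)))
  x (Vec.take p (oneLine (std (x ++ y)))) (λ i → sym (Vec.lookup-++ˡ x y i)) (lookup-take (oneLine (std (x ++ y))))

std-drop-oneLine : (x : Vec Letter p) (y : Vec Letter q) →
                   std (Vec.drop p (oneLine (std (x ++ y)))) ≈ₚ std y
std-drop-oneLine {p} {q} x y = std-subword (x ++ y) (p ↑ʳ_)
  (λ {i} {j} i<j → subst₂ _<_ (sym (Fin.toℕ-↑ʳ p i)) (sym (Fin.toℕ-↑ʳ p j)) (ℕ.+-monoʳ-< p i<j))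
  y (Vec.drop p (oneLine (std (x ++ y)))) (λ i → sym (Vec.lookup-++ʳ x y i)) (lookup-drop (oneLine (std (x ++ y))))

std-++-InConvolution : (x : Vec Letter p) (y : Vec Letter q)
                       (σ′ : Permutation′ p) (σ″ : Permutation′ q) →
                       InConvolution (std (x ++ y)) σ′ σ″ ⇔ (std x ≈ₚ σ′ × std y ≈ₚ σ″)
std-++-InConvolution x y σ′ σ″ = mk⇔
  (λ (e , e′) → (λ i → trans (sym (std-take-oneLine x y i)) (e i))
              , (λ i → trans (sym (std-drop-oneLine x y i)) (e′ i)))
  (λ (e , e′) → (λ i → trans (std-take-oneLine x y i) (e i))
              , (λ i → trans (std-drop-oneLine x y i) (e′ i)))

-- `oneLine` turns pointwise equal permutations into propositionally equal vectors, along which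
-- `subst` can transport. Filtering the list of permutations up to `_≈ₚ_` relies on this.
InConvolution-resp : (σ′ : Permutation′ p) (σ″ : Permutation′ q) {σ τ : Permutation′ (p + q)} →
                     σ ≈ₚ τ → InConvolution σ σ′ σ″ → InConvolution τ σ′ σ″
InConvolution-resp {p} σ′ σ″ σ≈τ = subst
  (λ w → std (Vec.take p w) ≈ₚ σ′ × std (Vec.drop p w) ≈ₚ σ″)
  (Vec.tabulate-cong (λ i → cong toℕ (σ≈τ i)))

-- Colored standardization of a concatenation

-- Packing the length together with the vector lets `cong` act on equalities between vectors whose
-- lengths agree only propositionally.
coloredStdᵛ : ∃ (Vec (Letter × Color ℓ)) → ColoredPerm ℓ
coloredStdᵛ (n , w) = n , std (Vec.map proj₁ w) , Vec.map proj₂ w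

fromList-++ : (x y : List X) →
              _≡_ {A = ∃ (Vec X)} (length (x List.++ y) , fromList (x List.++ y))
                                  (length x + length y , fromList x ++ fromList y)
fromList-++ []      y = refl
fromList-++ (a ∷ x) y = cong (λ (n , v) → suc n , a Vec.∷ v) (fromList-++ x y)

coloredStd-++ : (x y : Word ℓ) → coloredStd (x List.++ y) ≡
                (length x + length y , std (letters x ++ letters y) , colors x ++ colors y)
coloredStd-++ x y = trans (cong coloredStdᵛ (fromList-++ x y))
  (cong₂ (λ v u → length x + length y , std v , u)
    (Vec.map-++ proj₁ (fromList x) (fromList y)) (Vec.map-++ proj₂ (fromList x) (fromList y)))

≋-⇔ : {σ τ : Permutation′ n} {u v : Vec (Color ℓ) n} →
      (n , σ , u) ≋ (n , τ , v) ⇔ (σ ≈ₚ τ × u ≡ v)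
≋-⇔ = mk⇔ (λ { (same e e′) → e , e′ }) (λ (e , e′) → same e e′)

G-≢ : ∀ (c : ColoredPerm ℓ) w → length w ≢ proj₁ c → coeff (G c) w ≡ 0ℤ
G-≢ c w w≢c = indicator-no (coloredStd w ≋? c) (w≢c ∘ ≋-size)

-- The product formula, coefficient by coefficient

module _ (τ : Permutation′ (p + q)) (u : Vec (Color ℓ) (p + q))
         (σ′ : Permutation′ p) (σ″ : Permutation′ q) (v : Vec (Color ℓ) (p + q)) where

  -- At most one term survives, the one at `σ ≈ₚ τ`, and the list contains such a `σ` exactly when
  -- `τ` lies in the convolution. `P` is arbitrary so that the sum can be matched with the decision
  -- arising from a product of two coefficients.
  sumℤ-⋆ : {P : Set} (P? : Dec P) → P ⇔ (InConvolution τ σ′ σ″ × u ≡ v) →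
           sumℤ (σ′ ⋆ σ″) (λ σ → indicator ((p + q , τ , u) ≋? (p + q , σ , v))) ≡ indicator P?
  sumℤ-⋆ P? P⇔ with P?
  ... | yes P-holds = sumℤ-single (permSetoid (p + q)) (λ σ → indicator ((p + q , τ , u) ≋? (p + q , σ , v))) {t = τ}
    (filter⁺ (permSetoid (p + q)) conv? (perms-unique (p + q)))
    (∈-filter⁺ (permSetoid (p + q)) conv?
      (λ {σ} {ρ} → InConvolution-resp σ′ σ″ {σ} {ρ}) {v = τ} (perms-complete τ) τ∈)
    (λ {σ} τ≈σ → indicator-yes ((p + q , τ , u) ≋? (p + q , σ , v)) (same τ≈σ u≡v))
    (λ {σ} τ≉σ → indicator-no ((p + q , τ , u) ≋? (p + q , σ , v))
                              (τ≉σ ∘ proj₁ ∘ Equivalence.to ≋-⇔))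
    where
    conv? = λ σ → inConvolution? σ σ′ σ″
    τ∈    = proj₁ (Equivalence.to P⇔ P-holds)
    u≡v   = proj₂ (Equivalence.to P⇔ P-holds)
  ... | no ¬P = sumℤ-0 (All.map (λ {σ} → zero-term {σ}) (All.all-filter (λ σ → inConvolution? σ σ′ σ″) (perms (p + q))))
    where
    zero-term : ∀ {σ} → InConvolution σ σ′ σ″ →
                indicator ((p + q , τ , u) ≋? (p + q , σ , v)) ≡ 0ℤ
    -- A nonzero term would give `τ ≈ₚ σ`, hence put `τ` in the convolution and make `P` true.
    zero-term {σ} σ∈ = indicator-no ((p + q , τ , u) ≋? (p + q , σ , v)) λ e →
      let τ≈σ , u≡v = Equivalence.to ≋-⇔ e in
      ¬P (Equivalence.from P⇔ (InConvolution-resp σ′ σ″ {σ} {τ} (λ i → sym (τ≈σ i)) σ∈ , u≡v))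

++-factor : ∀ p (w : List X) → length w ≡ p + q →
            ∃₂ λ x y → w ≡ x List.++ y × length x ≡ p × length y ≡ q
++-factor ℕ.zero  w       e = [] , w , refl , refl , e
++-factor (suc p) (a ∷ w) e with ++-factor p w (ℕ.suc-injective e)
... | x , y , w≡ , x≡ , y≡ = a ∷ x , y , cong (a ∷_) w≡ , cong suc x≡ , y≡

module _ (σ′ : Permutation′ p) (u′ : Vec (Color ℓ) p) (σ″ : Permutation′ q) (u″ : Vec (Color ℓ) q) where

  private
    G′ = G (p , σ′ , u′)
    G″ = G (q , σ″ , u″)
    G⋆ = λ σ → G (p + q , σ , u′ ++ u″)

  G-⊛-++ : ∀ x y → length x ≡ p → length y ≡ q →
           coeff (G′ ⊛ G″) (x List.++ y) ≡ sumℤ (σ′ ⋆ σ″) (λ σ → coeff (G⋆ σ) (x List.++ y))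
  -- Matching on `refl` identifies `p` and `q` with the lengths of `x` and `y`, so that the color
  -- words on both sides have the same type and can be split at the same place.
  G-⊛-++ x y refl refl = begin
    cauchy (coeff G′) (coeff G″) (x List.++ y)
      ≡⟨ cauchy-++ (coeff G′) (coeff G″) x y (G-≢ (p , σ′ , u′)) ⟩
    coeff G′ x ℤ.* coeff G″ y
      ≡⟨ indicator-× x? y? ⟩
    indicator (x? ×-dec y?)
      ≡⟨ sumℤ-⋆ (std (letters x ++ letters y)) (colors x ++ colors y) σ′ σ″ (u′ ++ u″)
                (x? ×-dec y?) (mk⇔ to from) ⟨
    sumℤ (σ′ ⋆ σ″) (λ σ → indicator (xy ≋? (p + q , σ , u′ ++ u″)))
      ≡⟨ cong (λ c → sumℤ (σ′ ⋆ σ″) (λ σ → indicator (c ≋? (p + q , σ , u′ ++ u″)))) (coloredStd-++ x y) ⟨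
    sumℤ (σ′ ⋆ σ″) (λ σ → coeff (G⋆ σ) (x List.++ y)) ∎
    where
    open ≡-Reasoning
    x? = coloredStd x ≋? (p , σ′ , u′)
    y? = coloredStd y ≋? (q , σ″ , u″)
    xy : ColoredPerm _
    xy = p + q , std (letters x ++ letters y) , colors x ++ colors y
    conv = std-++-InConvolution (letters x) (letters y) σ′ σ″
    to : coloredStd x ≋ (p , σ′ , u′) × coloredStd y ≋ (q , σ″ , u″) →
         InConvolution (std (letters x ++ letters y)) σ′ σ″ × colors x ++ colors y ≡ u′ ++ u″
    to (x≋ , y≋) =
      let e′ , c′ = Equivalence.to ≋-⇔ x≋
          e″ , c″ = Equivalence.to ≋-⇔ y≋
      in Equivalence.from conv (e′ , e″) , cong₂ _++_ c′ c″
    from : InConvolution (std (letters x ++ letters y)) σ′ σ″ × colors x ++ colors y ≡ u′ ++ u″ →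
           coloredStd x ≋ (p , σ′ , u′) × coloredStd y ≋ (q , σ″ , u″)
    from (τ∈ , c) =
      let e′ , e″ = Equivalence.to conv τ∈
          c′ , c″ = Vec.++-injective (colors x) u′ c
      in same e′ c′ , same e″ c″

  G-⊛ : G′ ⊛ G″ ≈ ∑[ σ ∈ σ′ ⋆ σ″ ] G⋆ σ
  G-⊛ w = trans (coefficients (length w ℕ.≟ p + q)) (sym (coeff-∑ (σ′ ⋆ σ″) G⋆ w))
    where
    factored : (∃₂ λ x y → w ≡ x List.++ y × length x ≡ p × length y ≡ q) →
               coeff (G′ ⊛ G″) w ≡ sumℤ (σ′ ⋆ σ″) (λ σ → coeff (G⋆ σ) w)
    factored (x , y , refl , x≡ , y≡) = G-⊛-++ x y x≡ y≡
    coefficients : Dec (length w ≡ p + q) →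
                   coeff (G′ ⊛ G″) w ≡ sumℤ (σ′ ⋆ σ″) (λ σ → coeff (G⋆ σ) w)
    coefficients (yes e) = factored (++-factor p w e)
    -- For a word of any other length both sides vanish: in each split at least one factor has the
    -- wrong length.
    coefficients (no w≢) = trans
      (sumℤ-0 (All.map (λ {xy} e → term xy e (length (proj₁ xy) ℕ.≟ p)) (splits-length w)))
      (sym (sumℤ-0 (All.universal (λ σ → G-≢ (p + q , σ , u′ ++ u″) w w≢) (σ′ ⋆ σ″))))
      where
      term : ∀ ((x , y) : Word _ × Word _) → length x + length y ≡ length w → Dec (length x ≡ p) →
             coeff G′ x ℤ.* coeff G″ y ≡ 0ℤ
      term (x , y) e (no x≢)  = cong (ℤ._* coeff G″ y) (G-≢ (p , σ′ , u′) x x≢)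
      term (x , y) e (yes x≡) = trans
        (cong (coeff G′ x ℤ.*_)
          (G-≢ (q , σ″ , u″) y λ y≡ → w≢ (trans (sym e) (cong₂ _+_ x≡ y≡))))
        (ℤ.*-zeroʳ (coeff G′ x))

-- Spans

module _ (F : S → Series X) where

  private
    ∑′ : List (ℤ × S) → Series X
    ∑′ ks = ∑[ kx ∈ ks ] (proj₁ kx • F (proj₂ kx))

  Span-resp-≈ : ∀ {f g} → f ≈ g → Span F f → Span F g
  Span-resp-≈ f≈g (ks , f≈) = ks , λ w → trans (sym (f≈g w)) (f≈ w)

  Span-𝟘 : Span F 𝟘
  Span-𝟘 = [] , λ _ → refl

  Span-generator : ∀ x → Span F (F x)
  Span-generator x = (1ℤ , x) ∷ [] , λ w →
    sym (trans (ℤ.+-identityʳ _) (ℤ.*-identityˡ (coeff (F x) w)))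

  Span-⊕ : ∀ {f g} → Span F f → Span F g → Span F (f ⊕ g)
  Span-⊕ (ks , f≈) (ls , g≈) = ks List.++ ls , λ w →
    trans (cong₂ ℤ._+_ (f≈ w) (g≈ w)) (sym (∑-++ ks w))
    where
    ∑-++ : ∀ ks → ∑′ (ks List.++ ls) ≈ ∑′ ks ⊕ ∑′ ls
    ∑-++ []             w = sym (ℤ.+-identityˡ _)
    ∑-++ ((k , x) ∷ ks) w = trans (ℤ-+-congʳ (k ℤ.* coeff (F x) w) (∑-++ ks w))
                                  (sym (ℤ.+-assoc (k ℤ.* coeff (F x) w) _ _))

  Span-• : ∀ k {f} → Span F f → Span F (k • f)
  Span-• k (ks , f≈) = List.map (Product.map₁ (k ℤ.*_)) ks , λ w →
    trans (cong (k ℤ.*_) (f≈ w)) (sym (∑-• ks w))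
    where
    ∑-• : ∀ ks → ∑′ (List.map (Product.map₁ (k ℤ.*_)) ks) ≈ k • ∑′ ks
    ∑-• []             w = sym (ℤ.*-zeroʳ k)
    ∑-• ((l , x) ∷ ks) w = trans
      (cong₂ ℤ._+_ (ℤ.*-assoc k l (coeff (F x) w)) (∑-• ks w))
      (sym (ℤ.*-distribˡ-+ k (l ℤ.* coeff (F x) w) _))

  Span-∑ : ∀ {T : Set} (xs : List T) (H : T → Series X) →
           (∀ x → Span F (H x)) → Span F (∑[ x ∈ xs ] H x)
  Span-∑ []       H H∈ = Span-𝟘
  Span-∑ (x ∷ xs) H H∈ = Span-⊕ {H x} {∑[ x ∈ xs ] H x} (H∈ x) (Span-∑ xs H H∈)

-- Bilinearity and products of spans

cauchy-*ʳ : ∀ k (f g : List X → ℤ) w → cauchy f (λ y → k ℤ.* g y) w ≡ k ℤ.* cauchy f g w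
cauchy-*ʳ k f g w = trans
  (sumℤ-cong (λ (x , y) → f x ℤ.* (k ℤ.* g y)) (λ (x , y) → k ℤ.* (f x ℤ.* g y))
             (λ (x , y) → swap (f x) (g y)) (splits w))
  (sumℤ-* k (λ (x , y) → f x ℤ.* g y) (splits w))
  where
  swap : ∀ a b → a ℤ.* (k ℤ.* b) ≡ k ℤ.* (a ℤ.* b)
  swap a b = trans (sym (ℤ.*-assoc a k b)) (trans (cong (ℤ._* b) (ℤ.*-comm a k)) (ℤ.*-assoc k a b))

cauchy-0ʳ : ∀ (f : List X → ℤ) w → cauchy f (λ _ → 0ℤ) w ≡ 0ℤ
cauchy-0ʳ f w = sumℤ-0 (All.universal (λ (x , _) → ℤ.*-zeroʳ (f x)) (splits w))

∑-⊛ : ∀ (xs : List S) (H : S → Series X) g → (∑[ x ∈ xs ] H x) ⊛ g ≈ ∑[ x ∈ xs ] (H x ⊛ g)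
∑-⊛ []       H g w = cauchy-0ˡ (coeff g) w
∑-⊛ (x ∷ xs) H g w = trans (cauchy-+ˡ (coeff (H x)) (coeff (∑[ x ∈ xs ] H x)) (coeff g) w)
                           (ℤ-+-congʳ (coeff (H x ⊛ g) w) (∑-⊛ xs H g w))

⊛-∑ : ∀ (xs : List S) (H : S → Series X) f → f ⊛ (∑[ x ∈ xs ] H x) ≈ ∑[ x ∈ xs ] (f ⊛ H x)
⊛-∑ []       H f w = cauchy-0ʳ (coeff f) w
⊛-∑ (x ∷ xs) H f w = trans (cauchy-+ʳ (coeff f) (coeff (H x)) (coeff (∑[ x ∈ xs ] H x)) w)
                           (ℤ-+-congʳ (coeff (f ⊛ H x) w) (⊛-∑ xs H f w))

module _ (F : S → Series X) (F-⊛ : ∀ x y → Span F (F x ⊛ F y)) where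

  -- Bilinearity reduces closure under products to products of generators, one factor at a time.
  -- Here the right factor is expanded; `Span-⊛` then expands the left one.
  Span-⊛-generator : ∀ x {g} → Span F g → Span F (F x ⊛ g)
  Span-⊛-generator x {g} (ls , g≈) = Span-resp-≈ F {∑[ ly ∈ ls ] (F x ⊛ H ly)} {F x ⊛ g}
    (λ w → trans (sym (⊛-∑ ls H (F x) w))
                 (cauchy-cong (coeff (F x)) (coeff (F x)) (coeff (∑[ ly ∈ ls ] H ly)) (coeff g)
                              (λ _ → refl) (sym ∘ g≈) w))
    (Span-∑ F ls (λ ly → F x ⊛ H ly) λ (l , y) → Span-resp-≈ F {l • (F x ⊛ F y)} {F x ⊛ H (l , y)}
      (λ w → sym (cauchy-*ʳ l (coeff (F x)) (coeff (F y)) w)) (Span-• F l {F x ⊛ F y} (F-⊛ x y)))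
    where H = λ (ly : ℤ × S) → proj₁ ly • F (proj₂ ly)

  Span-⊛ : ∀ {f g} → Span F f → Span F g → Span F (f ⊛ g)
  Span-⊛ {f} {g} (ks , f≈) g∈ = Span-resp-≈ F {∑[ kx ∈ ks ] (H kx ⊛ g)} {f ⊛ g}
    (λ w → trans (sym (∑-⊛ ks H g w))
                 (cauchy-cong (coeff (∑[ kx ∈ ks ] H kx)) (coeff f) (coeff g) (coeff g)
                              (sym ∘ f≈) (λ _ → refl) w))
    (Span-∑ F ks (λ kx → H kx ⊛ g) λ (k , x) → Span-resp-≈ F {k • (F x ⊛ g)} {H (k , x) ⊛ g}
      (λ w → sym (cauchy-*ˡ k (coeff (F x)) (coeff g) w))
      (Span-• F k {F x ⊛ g} (Span-⊛-generator x {g} g∈)))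
    where H = λ (kx : ℤ × S) → proj₁ kx • F (proj₂ kx)

-- The subalgebra `FQSym`

-- The empty word is the only word of length 0, so the unit is itself a generator.
G-empty : G {ℓ} (0 , Perm.id , Vec.[]) ≈ 𝟙
G-empty {ℓ} []  = indicator-yes (coloredStd {ℓ} [] ≋? (0 , Perm.id , Vec.[])) (same (λ ()) refl)
G-empty (a ∷ w) = G-≢ (0 , Perm.id , Vec.[]) (a ∷ w) λ ()

FQSym-isSubalgebra : IsSubalgebra (FQSym ℓ)
FQSym-isSubalgebra = record
  { resp-≈   = λ {f} {g} → Span-resp-≈ G {f} {g}
  ; ⊕-closed = λ {f} {g} → Span-⊕ G {f} {g}
  ; •-closed = λ k {f} → Span-• G k {f}
  ; 𝟙-closed = Span-resp-≈ G {G (0 , Perm.id , Vec.[])} {𝟙} G-empty (Span-generator G _)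
  ; ⊛-closed = λ {f} {g} → Span-⊛ G G-⊛-G {f} {g}
  }
  where
  -- The product formula expresses this product as a finite sum of generators.
  G-⊛-G : ∀ c d → Span G (G c ⊛ G d)
  G-⊛-G c@(p , σ′ , u′) d@(q , σ″ , u″) =
    Span-resp-≈ G {∑[ σ ∈ σ′ ⋆ σ″ ] G (p + q , σ , u′ ++ u″)} {G c ⊛ G d}
      (λ w → sym (G-⊛ σ′ u′ σ″ u″ w))
      (Span-∑ G (σ′ ⋆ σ″) (λ σ → G (p + q , σ , u′ ++ u″))
        (λ σ → Span-generator G (p + q , σ , u′ ++ u″)))

theorem3p2 : (ℓ : ℕ) →
    (∀ {p q} (σ′ : Permutation′ p) (u′ : Vec (Color ℓ) p)
    (σ″ : Permutation′ q) (u″ : Vec (Color ℓ) q) →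
    G (p , σ′ , u′) ⊛ G (q , σ″ , u″) ≈ ∑[ σ ∈ σ′ ⋆ σ″ ] G (p + q , σ , u′ ++ u″))
    × IsSubalgebra (FQSym ℓ)
theorem3p2 ℓ = G-⊛ , FQSym-isSubalgebra
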